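{- Let $G$ be a trapezoid graph and $U=\{u_1,\ldots,u_k\}$ a set of vertices of $G$ such that $\delta^*_{u_i}\neq\emptyset$ for every $i=1,\ldots,k$. Let $H_0=G$, let $H_i=H_{i-1}^{\#}(u_i)$ be obtained from $H_{i-1}$ by the vertex splitting of $u_i$ (for $i=1,\ldots,k$), and let $G^{\#}(U)$ be the subgraph of $H_k$ induced by all vertices except those of $V(G)\setminus U$ (i.e., only the derivatives remain). Then $G^{\#}(U)$ is a permutation graph with $2k$ vertices. Furthermore, if $G$ is an acyclic trapezoid graph, then $G^{\#}(U)$ is an acyclic permutation graph with respect to $\{u_i^1,u_i^2\}_{i=1}^k$, where $u_i^1,u_i^2$ are the derivatives of $u_i$.
   Context: All graphs are finite and simple. $N(u)$ is the neighborhood of $u$, $N[u]=N(u)\cup\{u\}$, and for a vertex set $W$, $N(W)=\bigcup_{w\in W}N(w)\setminus W$. For a vertex $u$ let $V_1,\ldots,V_\omega$ be the vertex sets of the connected components of $G\setminus N[u]$. $D_u(V_i)=\{V_p: N(V_p)\subseteq N(V_i)\}$; $V_i$ is a master component of $u$ if $|D_u(V_i)|\ge |D_u(V_j)|$ for all $j$; $D^*_u(V_i)=\{V_1,\ldots,V_\omega\}\setminus D_u(V_i)$; a component $V_j$ in a set $S$ of components is maximal in $S$ if there is no $V_l\in S$ with $N(V_j)\subsetneq N(V_l)$. Fix an arbitrary master component $V_i$ of $u$ and set $\delta_u=V_i$; if $D^*_u(V_i)=\emptyset$ set $\delta^*_u=\emptyset$, otherwise $\delta^*_u=V_j$ for an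 arbitrary maximal component $V_j$ of $D^*_u(V_i)$. Partition $N(u)$ into $N_0(u)$ (neighbors adjacent to no vertex of $\delta_u$ and no vertex of $\delta^*_u$), $N_1(u)$ (adjacent to $\delta_u$ but not to $\delta^*_u$), $N_2(u)$ (adjacent to $\delta^*_u$ but not to $\delta_u$), $N_{12}(u)$ (adjacent to both). Vertex splitting of $u$ (when $\delta^*_u\neq\emptyset$): $G^{\#}(u)$ has vertex set $V(G)\setminus\{u\}\cup\{u_1,u_2\}$ (new vertices, the derivatives of $u$), all edges of $G$ not incident to $u$, and the edges $u_1x$ for $x\in N_1(u)\cup N_{12}(u)$ and $u_2x$ for $x\in N_2(u)\cup N_{12}(u)$. In the procedure these notions are computed in the current graph $H_{i-1}$. Representations: $L_1,L_2$ are horizontal parallel lines; a permutation representation consists of segments ("lines") from $L_1$ to $L_2$ with distinct endpoints, the graph having lines as vertices, adjacent iff crossing. For a permutation representation $R$, $\theta_R(x)$ is the angle of line $x$ with $L_2$, and $\Phi_R$ orients each edge $xy$ from $x$ to $y$ iff $\theta_R(x)<\theta_R(y)$. If the $2n$ vertices of a permutation graph $P$ are grouped into $n$ pairs $\{w_i^1,w_i^2\}$, let $F_R$ be the directed graph on $\{w_1,\ldots,w_n\}$ obtained by merging each pair into $w_i$, with an arc $w_i\to w_j$ ($i\ne j$) whenever $\Phi_R$ has an arc from a member of pair $i$ to a member of pair $j$. $R$ is acyclic w.r.t. the pairs if $F_R$ has no directed cycle; $P$ is acyclic w.r.t. the pairs if it has such a representation. A trapezoid representation (trapezoids between $L_1$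 and $L_2$, all endpoints distinct, graph = intersection graph) is acyclic if the permutation representation formed by the left and right lines of all trapezoids is acyclic with respect to the pairs $\{$left line of $T_u$, right line of $T_u\}$; a trapezoid graph is acyclic if it has an acyclic trapezoid representation. -}

module Defs where

open import Level using (0ℓ)
open import Data.Nat using (ℕ; zero; suc; _+_; _<_; _≤_)
open import Data.Fin using (Fin; fromℕ<) renaming (zero to fzero; suc to fsuc)
open import Data.Product using (Σ; Σ-syntax; _×_; _,_; proj₁)
open import Data.Sum using (_⊎_; inj₁; inj₂)
open import Data.Unit using (⊤)
open import Data.Empty using (⊥)
open import Data.List using (List; length)
open import Data.List.Relation.Unary.Any using (Any)
open import Data.List.Relation.Unary.All using (All)
open import Data.List.Relation.Unary.AllPairs using (AllPairs)
open import Relation.Nullary using (¬_)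
open import Relation.Binary.PropositionalEquality using (_≡_; _≢_)
open import Relation.Binary.Construct.Closure.ReflexiveTransitive using (Star)
open import Relation.Binary.Construct.Closure.Transitive using (TransClosure)
open import Function.Definitions using (Injective)
open import Function.Bundles using (_⇔_)

record SimpleGraph (n : ℕ) : Set₁ where
  field
    Adj    : Fin n → Fin n → Set
    sym    : ∀ {x y} → Adj x y → Adj y x
    irrefl : ∀ {x} → ¬ Adj x x

-- Permutation representations.  L1 is the upper line, L2 the lower one;
-- line x has endpoint p x on L1 and q x on L2 (only the order of the
-- endpoints matters, so natural-number coordinates suffice).

record PermRep (W : Set) : Set where
  field
    p    : W → ℕ
    q    : W → ℕ
    p-inj : Injective _≡_ _≡_ p
    q-inj : Injective _≡_ _≡_ q
open PermRep public

Cross : {W : Set} → PermRep W → W → W → Set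
Cross R x y = (p R x < p R y × q R y < q R x) ⊎ (p R y < p R x × q R x < q R y)

-- θ_R x < θ_R y.  Line x goes from (q x , 0) on L2 to (p x , 1) on L1;
-- its angle with L2 is arccot (p x − q x), which is strictly decreasing
-- in p x − q x.  So θ x < θ y  iff  p y − q y < p x − q x,
-- i.e.  p y + q x < p x + q y.
ThetaLt : {W : Set} → PermRep W → W → W → Set
ThetaLt R x y = p R y + q R x < p R x + q R y

PhiArc : {W : Set} → PermRep W → W → W → Set
PhiArc R x y = Cross R x y × ThetaLt R x y

Represents : {W : Set} → PermRep W → (W → W → Set) → Set
Represents {W} R adj = ∀ (x y : W) → adj x y ⇔ Cross R x y

IsPermutationGraph : (W : Set) → (W → W → Set) → Set
IsPermutationGraph W adj = Σ (PermRep W) λ R → Represents R adj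

-- F_R for a grouping π : W → P of the lines into pairs
FArc : {W P : Set} → PermRep W → (W → P) → P → P → Set
FArc {W} R π a b = a ≢ b × Σ W λ x → Σ W λ y → π x ≡ a × π y ≡ b × PhiArc R x y

AcyclicWrt : {W P : Set} → PermRep W → (W → P) → Set
AcyclicWrt {W} {P} R π = ∀ (a : P) → ¬ TransClosure (FArc R π) a a

IsAcyclicPermutationGraphPairs : (k : ℕ) → (Fin k × Fin 2 → Fin k × Fin 2 → Set) → Set
IsAcyclicPermutationGraphPairs k adj =
  Σ (PermRep (Fin k × Fin 2)) λ R → Represents R adj × AcyclicWrt R proj₁

-- Trapezoid representations.  T_v has top endpoints a v < b v on L1 and
-- bottom endpoints c v < d v on L2; left line (a v , c v), right line
-- (b v , d v).  All endpoints on each line are distinct.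

record TrapRep (n : ℕ) : Set where
  field
    a b c d : Fin n → ℕ
    a<b : ∀ v → a v < b v
    c<d : ∀ v → c v < d v
    lines : PermRep (Fin n × Fin 2)
    lines-p0 : ∀ v → p lines (v , fzero) ≡ a v
    lines-p1 : ∀ v → p lines (v , fsuc fzero) ≡ b v
    lines-q0 : ∀ v → q lines (v , fzero) ≡ c v
    lines-q1 : ∀ v → q lines (v , fsuc fzero) ≡ d v
open TrapRep public

-- Two trapezoids (between the same two lines, distinct endpoints) are
-- disjoint iff one lies strictly to the left of the other on both lines.
TrapIntersect : {n : ℕ} → TrapRep n → Fin n → Fin n → Set
TrapIntersect T u v =
  ¬ ((b T u < a T v × d T u < c T v) ⊎ (b T v < a T u × d T v < c T u))

TrapRepresents : {n : ℕ} → TrapRep n → SimpleGraph n → Set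
TrapRepresents T G = ∀ u v → u ≢ v → SimpleGraph.Adj G u v ⇔ TrapIntersect T u v

IsTrapezoidGraph : {n : ℕ} → SimpleGraph n → Set
IsTrapezoidGraph {n} G = Σ (TrapRep n) λ T → TrapRepresents T G

IsAcyclicTrapezoidGraph : {n : ℕ} → SimpleGraph n → Set
IsAcyclicTrapezoidGraph {n} G =
  Σ (TrapRep n) λ T → TrapRepresents T G × AcyclicWrt (lines T) proj₁

-- Graphs on a subset of a fixed universe of vertex labels V
-- (used for the intermediate graphs H_i).

record Graph (V : Set) : Set₁ where
  field
    present : V → Set
    adj     : V → V → Set
open Graph public

module _ {V : Set} (H : Graph V) (u : V) where

  InW : V → Set
  InW x = present H x × x ≢ u × ¬ adj H u x

  WAdj : V → V → Set
  WAdj x y = InW x × InW y × adj H x y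

  Comp : V → V → Set
  Comp r x = InW r × Star WAdj r x

  NComp : V → V → Set
  NComp r y = ¬ Comp r y × Σ V λ x → Comp r x × adj H x y

  Sub : (V → Set) → (V → Set) → Set
  Sub A B = ∀ y → A y → B y

  StrictSub : (V → Set) → (V → Set) → Set
  StrictSub A B = Sub A B × ¬ Sub B A

  -- component of s belongs to D_u(component of r)
  InD : V → V → Set
  InD r s = InW s × Sub (NComp s) (NComp r)

  InDstar : V → V → Set
  InDstar r s = InW s × ¬ Sub (NComp s) (NComp r)

  -- |D_u(component of r)| ≡ m : witnessed by a list of representatives,
  -- one from each component of D_u(component of r)
  CardD : V → ℕ → Set
  CardD r m = Σ (List V) λ l →
      All (InD r) l
    × AllPairs (λ x y → ¬ Comp x y) l
    × (∀ s → InD r s → Any (Comp s) l)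
    × length l ≡ m

  Master : V → Set
  Master r = InW r × ∀ s → InW s → ∀ m m′ → CardD s m′ → CardD r m → m′ ≤ m

  MaximalDstar : V → V → Set
  MaximalDstar r s = InDstar r s × ∀ t → InDstar r t → ¬ StrictSub (NComp s) (NComp t)

  DeltaStarNonempty : Set
  DeltaStarNonempty = Σ V λ r → Master r × Σ V λ s → InDstar r s

  -- a legal choice of δ_u (component of r) and δ*_u ≠ ∅ (component of s)
  record SplitChoice : Set where
    field
      r : V
      s : V
      r-master : Master r
      s-maximal : MaximalDstar r s

  -- N_1(u) ∪ N_12(u), resp. N_2(u) ∪ N_12(u)
  NbrOf : V → V → Set
  NbrOf r y = adj H u y × Σ V λ z → Comp r z × adj H y z

split : {V : Set} (H : Graph V) (u d1 d2 : V) → SplitChoice H u → Graph V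
split {V} H u d1 d2 ch = record
  { present = λ x → (present H x × x ≢ u) ⊎ (x ≡ d1 ⊎ x ≡ d2)
  ; adj = λ x y →
        (x ≢ u × y ≢ u × adj H x y)
      ⊎ (x ≡ d1 × A1 y) ⊎ (y ≡ d1 × A1 x)
      ⊎ (x ≡ d2 × A2 y) ⊎ (y ≡ d2 × A2 x)
  }
  where
    A1 = NbrOf H u (SplitChoice.r ch)
    A2 = NbrOf H u (SplitChoice.s ch)

-- The procedure for G on Fin n and U = {u 0, …, u (k-1)}.
-- Vertex universe: inj₁ v is the original vertex v of G, inj₂ (i , j)
-- is the derivative u_i^{j+1} of u i.

Vtx : ℕ → ℕ → Set
Vtx n k = Fin n ⊎ (Fin k × Fin 2)

H₀ : {n k : ℕ} → SimpleGraph n → Graph (Vtx n k)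
H₀ G = record { present = pres ; adj = ad }
  where
    pres : _ → Set
    pres (inj₁ _) = ⊤
    pres (inj₂ _) = ⊥
    ad : _ → _ → Set
    ad (inj₁ x) (inj₁ y) = SimpleGraph.Adj G x y
    ad _ _ = ⊥

-- Run G u i H : H is a possible H_i (for some legal choices of the
-- master component and of the maximal component at each step)
data Run {n k : ℕ} (G : SimpleGraph n) (u : Fin k → Fin n) :
         ℕ → Graph (Vtx n k) → Set₁ where
  start : Run G u 0 (H₀ G)
  step  : ∀ {i H} (i<k : i < k) → Run G u i H →
          (ch : SplitChoice H (inj₁ (u (fromℕ< i<k)))) →
          Run G u (suc i)
            (split H (inj₁ (u (fromℕ< i<k)))
                     (inj₂ (fromℕ< i<k , fzero))
                     (inj₂ (fromℕ< i<k , fsuc fzero)) ch)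

InGsharp : {n k : ℕ} → (Fin k → Fin n) → Graph (Vtx n k) → Vtx n k → Set
InGsharp {n} {k} u H x =
  present H x × ¬ (Σ (Fin n) λ v → x ≡ inj₁ v × (∀ i → u i ≢ v))

{-# OPTIONS --safe #-}

-- Fix a trapezoid representation T and write x ≪ y if x lies entirely to the
-- left of y.  Each component of the non-neighbours of u lies on one side of u,
-- and on each side the neighbourhoods of the components form a chain whose
-- largest member comes from the component closest to u.  Counting shows that the
-- neighbourhood of a master component contains those of all components on its
-- side; hence D* lies on the other side, and there the maximal component does the
-- same.  So the derivatives of u are realised by the tightest line to the right of
-- everything that is ≪ u and the tightest line to the left of everything that
-- u is ≪ of; they lie outside of the trapezoid of u.
--
-- For acyclicity, if w is the left derivative of u, then every x ≪ T_u other than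
-- w, where T_u is the trapezoid of u in T, is comparable with w; this survives all
-- later splittings.  It forces every crossing of derivatives of different vertices
-- to occur, in the same direction, between the corresponding lines of T, so a
-- directed cycle among the derivatives yields one in T.
module Submission where

open import Defs
open import Data.Nat using (ℕ; suc; _+_; _*_; _<_; _≤_; s≤s)
open import Data.Nat.Properties using (≤-refl; ≤-trans; <-trans; <-≤-trans; ≤-<-trans; <⇒≤; <⇒≱; <⇒≢; ≮⇒≥; ≰⇒>; ≤∧≢⇒<; <-irrefl; <-asym; <-cmp; _<?_; _≤?_; m≤n⇒m≤1+n; m<1+n⇒m<n∨m≡n; n<1+n; *-suc; *-monoʳ-≤; *-monoʳ-<; *-cancelˡ-<; *-cancelˡ-≡; suc-injective; +-mono-<)
open import Data.Fin using (Fin; fromℕ<; toℕ) renaming (zero to fzero; suc to fsuc)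
open import Data.Fin.Properties using (toℕ-fromℕ<; toℕ-injective; toℕ<n) renaming (_≟_ to _≟F_; all? to allF?)
open import Data.Product using (Σ; ∃; _×_; _,_; proj₁; proj₂; uncurry)
open import Data.Product.Properties using () renaming (≡-dec to ×-≡-dec)
open import Data.Sum using (_⊎_; inj₁; inj₂; [_,_]′; map₂) renaming (swap to ⊎-swap)
open import Data.Sum.Properties using () renaming (≡-dec to ⊎-≡-dec)
open import Data.Empty using (⊥-elim)
open import Data.List using (List; []; _∷_; _++_; map; length; allFin; cartesianProduct)
open import Data.List.Membership.Propositional using (_∈_; lose)
open import Data.List.Membership.Propositional.Properties using (∈-++⁺ˡ; ∈-++⁺ʳ; ∈-map⁺; ∈-allFin; ∈-cartesianProduct⁺)
open import Data.List.Relation.Unary.Any using (Any; here; there; any?; satisfied)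
open import Data.List.Relation.Unary.All as All using (All; []; _∷_; all?)
open import Data.List.Relation.Unary.All.Properties using (¬Any⇒All¬)
open import Data.List.Relation.Unary.AllPairs using (AllPairs; []; _∷_)
open import Function using (_∘_; flip; id)
open import Function.Bundles using (_⇔_; mk⇔; Equivalence)
open import Function.Definitions using (Injective)
open import Relation.Nullary using (¬_; Dec; yes; no; contradiction)
open import Relation.Nullary.Decidable using (map′; ¬?; _×-dec_; _⊎-dec_; _→-dec_; decidable-stable)
open import Relation.Binary using (tri<; tri≈; tri>; Decidable; DecidableEquality; Transitive)
open import Relation.Binary.Construct.Closure.ReflexiveTransitive using (Star; ε; _◅_; _◅◅_; reverse)
open import Relation.Binary.Construct.Closure.Transitive using (TransClosure; [_]; _∷_)
open import Relation.Binary.PropositionalEquality using (_≡_; _≢_; refl; sym; trans; cong; subst; subst₂)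

private variable
  V : Set

-- Decidable reachability and maximal elements in finite types.

module _ {V : Set} (R : V → V → Set) where

  -- Paths whose interior vertices lie in the list, as in the Floyd–Warshall algorithm.
  Via : List V → V → V → Set
  Via []       x y = x ≡ y ⊎ R x y
  Via (v ∷ vs) x y = Via vs x y ⊎ (Via vs x v × Via vs v y)

  via? : DecidableEquality V → Decidable R → ∀ vs → Decidable (Via vs)
  via? _≟_ R? []       x y = (x ≟ y) ⊎-dec R? x y
  via? _≟_ R? (v ∷ vs) x y =
    via? _≟_ R? vs x y ⊎-dec (via? _≟_ R? vs x v ×-dec via? _≟_ R? vs v y)

  via⇒star : ∀ vs {x y} → Via vs x y → Star R x y
  via⇒star []       (inj₁ refl)    = ε
  via⇒star []       (inj₂ e)       = e ◅ ε
  via⇒star (v ∷ vs) (inj₁ h)       = via⇒star vs h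
  via⇒star (v ∷ vs) (inj₂ (h , k)) = via⇒star vs h ◅◅ via⇒star vs k

  edge⇒via : ∀ vs {x y} → x ≡ y ⊎ R x y → Via vs x y
  edge⇒via []       e = e
  edge⇒via (v ∷ vs) e = inj₁ (edge⇒via vs e)

  -- If both paths visit `v`, keep the part before the first visit and the part after the last one;
  -- the detour in between, which contains `w`, is dropped.
  via-trans : ∀ vs {x w y} → w ∈ vs → Via vs x w → Via vs w y → Via vs x y
  via-trans (v ∷ vs) (here refl) h k =
    inj₂ ([ id , proj₁ ]′ h , [ id , proj₂ ]′ k)
  via-trans (v ∷ vs) (there m) (inj₁ h) (inj₁ k) = inj₁ (via-trans vs m h k)
  via-trans (v ∷ vs) (there m) (inj₁ h) (inj₂ (k , k′)) = inj₂ (via-trans vs m h k , k′)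
  via-trans (v ∷ vs) (there m) (inj₂ (h , h′)) (inj₁ k) = inj₂ (h , via-trans vs m h′ k)
  via-trans (v ∷ vs) (there m) (inj₂ (h , _)) (inj₂ (_ , k)) = inj₂ (h , k)

  star⇒via : ∀ vs → (∀ x → x ∈ vs) → ∀ {x y} → Star R x y → Via vs x y
  star⇒via vs full ε = edge⇒via vs (inj₁ refl)
  star⇒via vs full (e ◅ es) =
    via-trans vs (full _) (edge⇒via vs (inj₂ e)) (star⇒via vs full es)

Maximal : (V → Set) → (V → V → Set) → V → Set
Maximal P _⊏_ t = P t × (∀ x → P x → ¬ t ⊏ x)

record Finite (V : Set) : Set where
  field
    elements : List V
    complete : ∀ x → x ∈ elements
    _≟_      : DecidableEquality V

  ∃? : {P : V → Set} → (∀ x → Dec (P x)) → Dec (∃ P)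
  ∃? P? = map′ satisfied (λ (x , px) → lose (complete x) px) (any? P? elements)

  ∀? : {P : V → Set} → (∀ x → Dec (P x)) → Dec (∀ x → P x)
  ∀? P? = map′ (λ all x → All.lookup all (complete x)) (λ h → All.tabulate (λ {x} _ → h x))
               (all? P? elements)

  star? : {R : V → V → Set} → Decidable R → Decidable (Star R)
  star? R? x y = map′ (via⇒star _ elements) (star⇒via _ elements complete)
                      (via? _ _≟_ R? elements x y)

  maximal : {P : V → Set} {_⊏_ : V → V → Set} → (∀ x → Dec (P x)) → Decidable _⊏_ →
            Transitive _⊏_ → (∀ {x} → ¬ x ⊏ x) → ∃ P →
            ∃ (Maximal P _⊏_)
  maximal {P} {_⊏_} P? _⊏?_ ⊏-trans ⊏-irrefl (t₀ , pt₀) =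
    let t , pt , max = go elements in t , pt , λ x → max x (complete x)
    where
    go : ∀ vs → Σ V λ t → P t × (∀ x → x ∈ vs → P x → ¬ t ⊏ x)
    go [] = t₀ , pt₀ , λ _ ()
    go (v ∷ vs) with go vs
    ... | t , pt , max with P? v ×-dec (t ⊏? v)
    ... | yes (pv , t⊏v) = v , pv , λ
      { x (here refl) _ v⊏v → ⊏-irrefl v⊏v
      ; x (there m) px v⊏x → max x m px (⊏-trans t⊏v v⊏x) }
    ... | no ¬v = t , pt , λ
      { x (here refl) px t⊏x → ¬v (px , t⊏x)
      ; x (there m) px t⊏x → max x m px t⊏x }

-- Components of the non-neighbours of `u`, and master components.

module Components {V : Set} (fin : Finite V) (H : Graph V)
  (present? : ∀ x → Dec (present H x)) (adj? : Decidable (adj H))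
  (adj-sym : ∀ {x y} → adj H x y → adj H y x) (u : V) where

  open Finite fin

  inW? : ∀ x → Dec (InW H u x)
  inW? x = present? x ×-dec (¬? (x ≟ u) ×-dec ¬? (adj? u x))

  comp? : Decidable (Comp H u)
  comp? r x = inW? r ×-dec star? (λ x y → inW? x ×-dec (inW? y ×-dec adj? x y)) r x

  ncomp? : Decidable (NComp H u)
  ncomp? r y = ¬? (comp? r y) ×-dec ∃? (λ x → comp? r x ×-dec adj? x y)

  sub? : ∀ s r → Dec (Sub H u (NComp H u s) (NComp H u r))
  sub? s r = ∀? (λ y → ncomp? s y →-dec ncomp? r y)

  inD? : Decidable (InD H u)
  inD? r s = inW? s ×-dec sub? s r

  star-inW : ∀ {r x} → Star (WAdj H u) r x → InW H u r → InW H u x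
  star-inW ε wr = wr
  star-inW ((_ , wy , _) ◅ es) _ = star-inW es wy

  comp-inW : ∀ {r x} → Comp H u r x → InW H u x
  comp-inW (wr , es) = star-inW es wr

  comp-sym : ∀ {r x} → Comp H u r x → Comp H u x r
  comp-sym c@(_ , es) = comp-inW c , reverse (λ (wx , wy , e) → wy , wx , adj-sym e) es

  comp-trans : ∀ {x y z} → Comp H u x y → Comp H u y z → Comp H u x z
  comp-trans (wx , es) (_ , es′) = wx , es ◅◅ es′

  comp-extend : ∀ {r x y} → Comp H u r x → InW H u y → adj H x y → Comp H u r y
  comp-extend c wy e = comp-trans c (comp-inW c , (comp-inW c , wy , e) ◅ ε)

  ncomp-resp : ∀ {x z} → Comp H u x z → Sub H u (NComp H u x) (NComp H u z)
  ncomp-resp c y (y∉ , v , cv , e) = y∉ ∘ comp-trans c , v , comp-trans (comp-sym c) cv , e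

  -- Greedy extension of `l`. From the empty list it computes the size of `D_u`; from a prescribed
  -- list it bounds that size from below.
  representatives : ∀ {r} vs l → All (InD H u r) l → AllPairs (λ x y → ¬ Comp H u x y) l →
    Σ (List V) λ l′ → All (InD H u r) l′ × AllPairs (λ x y → ¬ Comp H u x y) l′
      × (∀ s → s ∈ vs → InD H u r s → Any (Comp H u s) l′) × length l ≤ length l′
  representatives [] l in-l apart = l , in-l , apart , (λ _ ()) , ≤-refl
  representatives {r} (v ∷ vs) l in-l apart with representatives vs l in-l apart
  ... | l′ , in-l′ , apart′ , cover , len with inD? r v ×-dec ¬? (any? (comp? v) l′)
  ... | yes (dv , v∉) = v ∷ l′ , dv ∷ in-l′ , ¬Any⇒All¬ l′ v∉ ∷ apart′
      , (λ { s (here refl) _ → here (proj₁ dv , ε) ; s (there m) ds → there (cover s m ds) })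
      , m≤n⇒m≤1+n len
  ... | no ¬v = l′ , in-l′ , apart′
      , (λ { s (here refl) ds → decidable-stable (any? (comp? s) l′) (λ s∉ → ¬v (ds , s∉))
           ; s (there m) ds → cover s m ds })
      , len

  -- Otherwise t together with representatives of D_u(r) would be part of a
  -- system of representatives of D_u(t).
  master-greatest : ∀ {r t} → Master H u r → InW H u t →
    Sub H u (NComp H u r) (NComp H u t) → Sub H u (NComp H u t) (NComp H u r)
  master-greatest {r} {t} (wr , most) wt r⊆t = decidable-stable (sub? t r) λ t⊈r →
    let lr , in-lr , apart-lr , cover-lr , _ = representatives {r} elements [] [] []
        in-t  = (wt , λ _ → id) ∷ All.map (λ (ws , s⊆r) → ws , λ y → r⊆t y ∘ s⊆r y) in-lr
        -- A representative in the component of `t` would have the neighbourhood of `t`, forcing it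
        -- into that of `r`.
        t∉lr  = All.map (λ (_ , s⊆r) c → t⊈r (λ y → s⊆r y ∘ ncomp-resp c y)) in-lr
        lt , in-lt , apart-lt , cover-lt , len =
          representatives elements (t ∷ lr) in-t (t∉lr ∷ apart-lr)
    in <⇒≱ len (most t wt _ _
         (lt , in-lt , apart-lt , (λ s → cover-lt s (complete s)) , refl)
         (lr , in-lr , apart-lr , (λ s → cover-lr s (complete s)) , refl))

-- Incomparability graphs and the components on one side of `u`.

Comparable : (V → V → Set) → V → V → Set
Comparable _≪_ x y = x ≪ y ⊎ y ≪ x

-- H is the incomparability graph of the strict order ≪ on its vertices.  For
-- trapezoids, x ≪ y means that x lies entirely to the left of y, and flipping
-- the order is reflection of the representation.
record Model {V : Set} (H : Graph V) (_≪_ : V → V → Set) : Set where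
  field
    present?    : ∀ x → Dec (present H x)
    _≪?_        : Decidable _≪_
    ≪-trans     : Transitive _≪_
    ≪-irrefl    : ∀ {x} → ¬ x ≪ x
    adj-present : ∀ {x y} → adj H x y → present H x × present H y
    adj-irrefl  : ∀ {x} → ¬ adj H x x
    adj⇒¬≪      : ∀ {x y} → adj H x y → ¬ Comparable _≪_ x y
    ¬≪⇒adj      : ∀ {x y} → present H x → present H y → x ≢ y →
                  ¬ Comparable _≪_ x y → adj H x y

reflect : {H : Graph V} {_≪_ : V → V → Set} → Model H _≪_ → Model H (flip _≪_)
reflect M = record
  { present? = present? ; _≪?_ = flip _≪?_ ; ≪-trans = flip ≪-trans ; ≪-irrefl = ≪-irrefl
  ; adj-present = adj-present ; adj-irrefl = adj-irrefl
  ; adj⇒¬≪ = λ e → adj⇒¬≪ e ∘ ⊎-swap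
  ; ¬≪⇒adj = λ px py x≢y n → ¬≪⇒adj px py x≢y (n ∘ ⊎-swap) }
  where open Model M

module OneSide {V : Set} (fin : Finite V) {H : Graph V} {_≪_ : V → V → Set}
  (M : Model H _≪_) {u : V} (u-present : present H u) where

  open Finite fin
  open Model M

  adj-sym : ∀ {x y} → adj H x y → adj H y x
  adj-sym {x} e = let px , py = adj-present e in
    ¬≪⇒adj py px (λ { refl → adj-irrefl e }) (adj⇒¬≪ e ∘ ⊎-swap)

  adj? : Decidable (adj H)
  adj? x y = map′
    (λ (px , py , x≢y , n) → ¬≪⇒adj px py x≢y n)
    (λ e → proj₁ (adj-present e) , proj₂ (adj-present e) , (λ { refl → adj-irrefl e }) , adj⇒¬≪ e)
    (present? x ×-dec (present? y ×-dec (¬? (x ≟ y) ×-dec ¬? ((x ≪? y) ⊎-dec (y ≪? x)))))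

  open Components fin H present? adj? adj-sym u

  Left : V → Set
  Left z = present H z × z ≪ u

  left? : ∀ z → Dec (Left z)
  left? z = present? z ×-dec (z ≪? u)

  inW-side : ∀ {x} → InW H u x → x ≪ u ⊎ u ≪ x
  inW-side {x} (px , x≢u , n) = decidable-stable ((x ≪? u) ⊎-dec (u ≪? x))
    (λ ¬cmp → n (adj-sym (¬≪⇒adj px u-present x≢u ¬cmp)))

  left-inW : ∀ {z} → Left z → InW H u z
  left-inW (pz , z≪u) = pz , (λ { refl → ≪-irrefl z≪u }) , λ e → adj⇒¬≪ e (inj₂ z≪u)

  -- An edge cannot jump across `u`: its ends would be comparable through `u`, hence not adjacent.
  star-left : ∀ {r x} → Star (WAdj H u) r x → r ≪ u → x ≪ u
  star-left ε r≪u = r≪u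
  star-left ((_ , wy , e) ◅ es) r≪u with inW-side wy
  ... | inj₁ y≪u = star-left es y≪u
  ... | inj₂ u≪y = ⊥-elim (adj⇒¬≪ e (inj₁ (≪-trans r≪u u≪y)))

  comp-left : ∀ {r x} → Left r → Comp H u r x → Left x
  comp-left (_ , r≪u) c@(_ , es) = proj₁ (comp-inW c) , star-left es r≪u

  -- A vertex next to a component but not adjacent to `u` would itself belong to the component.
  ncomp⇒adj : ∀ {r y} → NComp H u r y → adj H u y
  ncomp⇒adj {r} {y} (y∉ , x , cx , e) = decidable-stable (adj? u y) λ n →
    y∉ (comp-extend cx (proj₂ (adj-present e) ,
                        (λ { refl → proj₂ (proj₂ (comp-inW cx)) (adj-sym e) }) , n) e)

  adj⇒ncomp : ∀ {r x y} → Comp H u r x → adj H x y → adj H u y → NComp H u r y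
  adj⇒ncomp {x = x} cx e ue = (λ cy → proj₂ (proj₂ (comp-inW cy)) ue) , x , cx , e

  Dominates : V → Set
  Dominates r = ∀ z → Left z → Sub H u (NComp H u z) (NComp H u r)

  -- Take `t` maximal for `≪` on the left; `r` only shows that such vertices exist. Let `y` be a
  -- neighbour of `u` adjacent to a left vertex `x`. If `t` misses `y`, then `t ≪ y`, so `x ≪ t`
  -- would contradict the edge `xy`, and `t ≪ x` the maximality of `t`. Hence `x` lies in the
  -- component of `t`.
  nearest : ∀ {r} → Left r → Σ V λ t → Left t × Dominates t
  nearest {r} left-r with maximal left? _≪?_ ≪-trans ≪-irrefl (r , left-r)
  ... | t , left-t , max = t , left-t , dom
    where
    dom : Dominates t
    dom z left-z y y∈@(_ , x , cx , e) with adj? t y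
    ... | yes ty = adj⇒ncomp (left-inW left-t , ε) ty (ncomp⇒adj y∈)
    ... | no ¬ty = adj⇒ncomp cx′ e uy
      where
      uy : adj H u y
      uy = ncomp⇒adj y∈
      left-x : Left x
      left-x = comp-left left-z cx
      t≪y : t ≪ y
      t≪y = decidable-stable (t ≪? y) λ n → ¬ty (¬≪⇒adj (proj₁ left-t) (proj₂ (adj-present e))
        (λ { refl → adj⇒¬≪ uy (inj₂ (proj₂ left-t)) })
        λ { (inj₁ ty) → n ty
          ; (inj₂ yt) → adj⇒¬≪ uy (inj₂ (≪-trans yt (proj₂ left-t))) })
      cx′ : Comp H u t x
      cx′ with t ≟ x
      ... | yes refl = left-inW left-t , ε
      ... | no t≢x = comp-extend (left-inW left-t , ε) (left-inW left-x)
        (¬≪⇒adj (proj₁ left-t) (proj₁ left-x) t≢x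
          λ { (inj₁ tx) → max x left-x tx
            ; (inj₂ xt) → adj⇒¬≪ e (inj₁ (≪-trans xt t≪y)) })

  -- The nearest component has a neighbourhood containing that of `r`, and by `master-greatest` the
  -- inclusion cannot be strict.
  master-dominates : ∀ {r} → Left r → Master H u r → Dominates r
  master-dominates {r} left-r m z left-z y =
    let t , left-t , dom = nearest left-r in
    master-greatest m (left-inW left-t) (dom r left-r) y ∘ dom z left-z y

  -- The nearest component `t` also lies in `D*`, since otherwise the neighbourhood of `s`,
  -- contained in that of `t`, would be contained in that of `r`. Maximality of `s` then rules out a
  -- strict inclusion.
  maximal-dominates : ∀ {r s} → Left s → MaximalDstar H u r s → Dominates s
  maximal-dominates {r} {s} left-s ((_ , s⊈r) , max) z left-z y =
    let t , left-t , dom = nearest left-s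
        t⊆s = decidable-stable (sub? t s) λ t⊈s →
          max t (left-inW left-t , λ t⊆r → s⊈r (λ v → t⊆r v ∘ dom s left-s v)) (dom s left-s , t⊈s)
    in t⊆s y ∘ dom z left-z y

-- Lines that realise the derivatives, and how guards survive a splitting.

-- dL and dR are the tightest lines to the right of all vertices preceding u and
-- to the left of all vertices following u; Old singles out the elements other
-- than dL and dR.
record Bracket {V : Set} (H : Graph V) (_≪_ : V → V → Set) (Old : V → Set) (u dL dR : V) : Set where
  field
    old   : ∀ {x} → present H x → Old x
    upper : ∀ {z} → present H z → z ≪ u → z ≪ dL
    least : ∀ {x} → Old x → (∀ z → present H z → z ≪ u → z ≪ x) → dL ≪ x
    lower : ∀ {z} → present H z → u ≪ z → dR ≪ z
    greatest : ∀ {x} → Old x → (∀ z → present H z → u ≪ z → x ≪ z) → x ≪ dR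

reflect-bracket : {H : Graph V} {_≪_ : V → V → Set} {Old : V → Set} {u dL dR : V} →
  Bracket H _≪_ Old u dL dR → Bracket H (flip _≪_) Old u dR dL
reflect-bracket B = record
  { old = old ; upper = lower ; least = greatest ; lower = upper ; greatest = least }
  where open Bracket B

module Splitting {V : Set} (fin : Finite V) {H : Graph V} {_≪_ : V → V → Set}
  (M : Model H _≪_) {u : V} (u-present : present H u)
  {Old : V → Set} {dL dR : V} (B : Bracket H _≪_ Old u dL dR) where

  open Finite fin
  open Model M
  open Bracket B
  open OneSide fin M u-present

  dL≪u : dL ≪ u
  dL≪u = least (old u-present) (λ _ _ z≪u → z≪u)

  u≪dR : u ≪ dR
  u≪dR = greatest (old u-present) (λ _ _ u≪z → u≪z)

  -- Such a `y` is adjacent to some `z` on the left, and `z ≪ dL`, so `dL ≪ y` is impossible;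
  -- `y ≪ dL` would give `y ≪ u` against the edge `uy`.
  nbr⇒crosses : ∀ {r y} → Left r → NbrOf H u r y → ¬ Comparable _≪_ dL y
  nbr⇒crosses left-r (_ , z , cz , yz) (inj₁ dL≪y) =
    let pz , z≪u = comp-left left-r cz in adj⇒¬≪ yz (inj₂ (≪-trans (upper pz z≪u) dL≪y))
  nbr⇒crosses left-r (uy , _) (inj₂ y≪dL) = adj⇒¬≪ uy (inj₂ (≪-trans y≪dL dL≪u))

  -- If all left vertices preceded `y`, `least` would give `dL ≪ y`. So some left `z` does not; it
  -- is adjacent to `y`, and the neighbourhood of its component is contained in that of `r`.
  crosses⇒nbr : ∀ {r y} → Dominates r → present H y → y ≢ u →
    ¬ Comparable _≪_ dL y → NbrOf H u r y
  crosses⇒nbr {r} {y} dom py y≢u ¬cmp with ∃? (λ z → left? z ×-dec ¬? (z ≪? y))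
  ... | no none = contradiction
    (inj₁ (least (old py) λ z pz z≪u → decidable-stable (z ≪? y) λ n → none (z , (pz , z≪u) , n)))
    ¬cmp
  ... | yes (z , left-z , z≪̸y) =
    let _ , x , cx , xy = dom z left-z y (adj⇒ncomp (left-inW left-z , ε) zy uy)
    in uy , x , cx , adj-sym xy
    where
    y≪̸u : ¬ y ≪ u
    y≪̸u y≪u = ¬cmp (inj₂ (upper py y≪u))
    uy : adj H u y
    uy = ¬≪⇒adj u-present py (y≢u ∘ sym)
      λ { (inj₁ u≪y) → ¬cmp (inj₁ (≪-trans dL≪u u≪y)) ; (inj₂ y≪u) → y≪̸u y≪u }
    zy : adj H z y
    zy = ¬≪⇒adj (proj₁ left-z) py (λ { refl → y≪̸u (proj₂ left-z) })
      λ { (inj₁ z≪y) → z≪̸y z≪y ; (inj₂ y≪z) → y≪̸u (≪-trans y≪z (proj₂ left-z)) }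

  guard-new : ∀ {x} → present H x ⊎ (x ≡ dL ⊎ x ≡ dR) → x ≪ u → x ≢ dL → Comparable _≪_ x dL
  guard-new (inj₁ px) x≪u _ = inj₁ (upper px x≪u)
  guard-new (inj₂ (inj₁ eq)) _ n = contradiction eq n
  guard-new (inj₂ (inj₂ refl)) x≪u _ = ⊥-elim (≪-irrefl (≪-trans x≪u u≪dR))

  -- Here `w` is an older derivative with owner `t`. The new line `dL` inherits comparability from
  -- the vertices before `u`: unless `w ≪ u`, the guard puts all of them before `w`, and `least`
  -- applies.
  guard-old : ∀ {w t} → present H w → u ≢ w →
    (∀ x → present H x → x ≪ t → x ≢ w → Comparable _≪_ x w) →
    ∀ {x} → present H x ⊎ (x ≡ dL ⊎ x ≡ dR) → x ≪ t → x ≢ w → Comparable _≪_ x w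
  guard-old pw u≢w guard (inj₁ px) x≪t x≢w = guard _ px x≪t x≢w
  guard-old {w} {t} pw u≢w guard (inj₂ (inj₁ refl)) dL≪t _ with w ≪? u
  ... | yes w≪u = inj₂ (upper pw w≪u)
  ... | no w≪̸u = inj₁ (least (old pw) below)
    where
    below : ∀ z → present H z → z ≪ u → z ≪ w
    below z pz z≪u with guard z pz (≪-trans (upper pz z≪u) dL≪t) (λ { refl → w≪̸u z≪u })
    ... | inj₁ z≪w = z≪w
    ... | inj₂ w≪z = contradiction (≪-trans w≪z z≪u) w≪̸u
  -- From `u ≪ dR ≪ t` the guard applies to `u` itself, which is still present before the splitting.
  guard-old pw u≢w guard (inj₂ (inj₂ refl)) dR≪t _ with guard u u-present (≪-trans u≪dR dR≪t) u≢w
  ... | inj₁ u≪w = inj₁ (lower pw u≪w)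
  ... | inj₂ w≪u = inj₂ (≪-trans w≪u u≪dR)

-- Inserting new endpoints between old ones.

-- Refined coordinates: around every old coordinate rescale m there is a fresh
-- coordinate just before it and one just after it.
rescale before after : ℕ → ℕ
rescale m = suc (3 * m)
before  m = 3 * m
after   m = suc (suc (3 * m))

private
  3*-gap : ∀ {m x} → m < x → 3 + 3 * m ≤ 3 * x
  3*-gap {m} {x} m<x = subst (_≤ 3 * x) (*-suc 3 m) (*-monoʳ-≤ 3 m<x)

rescale-mono-< : ∀ {x y} → x < y → rescale x < rescale y
rescale-mono-< x<y = s≤s (*-monoʳ-< 3 x<y)

rescale-cancel-< : ∀ {x y} → rescale x < rescale y → x < y
rescale-cancel-< (s≤s h) = *-cancelˡ-< 3 _ _ h

rescale<after : ∀ {x m} → x ≤ m → rescale x < after m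
rescale<after x≤m = s≤s (s≤s (*-monoʳ-≤ 3 x≤m))

after<rescale : ∀ {m x} → m < x → after m < rescale x
after<rescale m<x = m≤n⇒m≤1+n (3*-gap m<x)

before<rescale : ∀ {m x} → m ≤ x → before m < rescale x
before<rescale m≤x = s≤s (*-monoʳ-≤ 3 m≤x)

rescale<before : ∀ {x m} → x < m → rescale x < before m
rescale<before x<m = ≤-trans (m≤n⇒m≤1+n ≤-refl) (3*-gap x<m)

-- Guarantees that a new endpoint coincides with no rescaled old one.
Fresh : ℕ → Set
Fresh m = ∀ x → m ≢ rescale x

after-fresh : ∀ m → Fresh (after m)
after-fresh m x eq with x ≤? m
... | yes x≤m = <⇒≢ (rescale<after x≤m) (sym eq)
... | no x≰m = <⇒≢ (after<rescale (≰⇒> x≰m)) eq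

rescale-injective : ∀ {x y} → rescale x ≡ rescale y → x ≡ y
rescale-injective = *-cancelˡ-≡ _ _ 3 ∘ suc-injective

before-fresh : ∀ m → Fresh (before m)
before-fresh m x eq with m ≤? x
... | yes m≤x = <⇒≢ (before<rescale m≤x) eq
... | no m≰x = <⇒≢ (rescale<before (≰⇒> m≰x)) (sym eq)

-- Layouts of trapezoids and derivative lines.

vertices : ∀ n k → Finite (Vtx n k)
vertices n k = record
  { elements = map inj₁ (allFin n) ++ map inj₂ (cartesianProduct (allFin k) (allFin 2))
  ; complete = λ
      { (inj₁ v) → ∈-++⁺ˡ (∈-map⁺ inj₁ (∈-allFin v))
      ; (inj₂ (j , e)) → ∈-++⁺ʳ (map inj₁ (allFin n))
          (∈-map⁺ inj₂ (∈-cartesianProduct⁺ (∈-allFin j) (∈-allFin e))) }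
  ; _≟_ = ⊎-≡-dec _≟F_ (×-≡-dec _≟F_ _≟F_) }

override : ∀ {k} → Fin k → (Fin 2 → ℕ) → (Fin k × Fin 2 → ℕ) → Fin k × Fin 2 → ℕ
override ι P p (j , e) with j ≟F ι
... | yes _ = P e
... | no  _ = rescale (p (j , e))

override-new : ∀ {k} (ι : Fin k) P p e → override ι P p (ι , e) ≡ P e
override-new ι P p e with ι ≟F ι
... | yes _ = refl
... | no n = contradiction refl n

override-old : ∀ {k} (ι : Fin k) P p {j} e → j ≢ ι → override ι P p (j , e) ≡ rescale (p (j , e))
override-old ι P p {j} e j≢ι with j ≟F ι
... | yes eq = contradiction eq j≢ι
... | no _ = refl

-- The coordinates of all trapezoids of T, in a common monotone rescaling, and
-- of one line for every derivative (junk for those not yet created).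
record Layout (k : ℕ) : Set where
  field
    scale      : ℕ → ℕ
    scale-mono : ∀ {x y} → x < y → scale x < scale y
    top bot    : Fin k × Fin 2 → ℕ

module _ {n k : ℕ} (T : TrapRep n) where

  -- A derivative is a degenerate trapezoid: its left and right sides coincide.
  topL topR botL botR : Layout k → Vtx n k → ℕ
  topL S (inj₁ v) = Layout.scale S (a T v)
  topL S (inj₂ w) = Layout.top S w
  topR S (inj₁ v) = Layout.scale S (b T v)
  topR S (inj₂ w) = Layout.top S w
  botL S (inj₁ v) = Layout.scale S (c T v)
  botL S (inj₂ w) = Layout.bot S w
  botR S (inj₁ v) = Layout.scale S (d T v)
  botR S (inj₂ w) = Layout.bot S w

  record LeftOf (S : Layout k) (x y : Vtx n k) : Set where
    constructor _∧_
    field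
      on-top : topR S x < topL S y
      on-bot : botR S x < botL S y
  open LeftOf

  topL≤topR : ∀ S x → topL S x ≤ topR S x
  topL≤topR S (inj₁ v) = <⇒≤ (Layout.scale-mono S (a<b T v))
  topL≤topR S (inj₂ w) = ≤-refl

  botL≤botR : ∀ S x → botL S x ≤ botR S x
  botL≤botR S (inj₁ v) = <⇒≤ (Layout.scale-mono S (c<d T v))
  botL≤botR S (inj₂ w) = ≤-refl

  leftOf-trans : ∀ S → Transitive (LeftOf S)
  leftOf-trans S {_} {y} (h ∧ h′) (g ∧ g′) =
    <-trans h (≤-<-trans (topL≤topR S y) g) ∧ <-trans h′ (≤-<-trans (botL≤botR S y) g′)

  leftOf-irrefl : ∀ S {x} → ¬ LeftOf S x x
  leftOf-irrefl S {x} (h ∧ _) = <⇒≱ h (topL≤topR S x)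

  leftOf? : ∀ S → Decidable (LeftOf S)
  leftOf? S x y = map′ (uncurry _∧_) (λ l → on-top l , on-bot l)
    ((topR S x <? topL S y) ×-dec (botR S x <? botL S y))

  extend : Layout k → Fin k → (P Q : Fin 2 → ℕ) → Layout k
  extend S ι P Q = record
    { scale = rescale ∘ Layout.scale S ; scale-mono = rescale-mono-< ∘ Layout.scale-mono S
    ; top = override ι P (Layout.top S) ; bot = override ι Q (Layout.bot S) }

  module Extend (S : Layout k) (ι : Fin k) (P Q : Fin 2 → ℕ) where

    S′ : Layout k
    S′ = extend S ι P Q

    Old : Vtx n k → Set
    Old x = ∀ e → x ≢ inj₂ (ι , e)

    private
      index≢ : ∀ {j e} → Old (inj₂ (j , e)) → j ≢ ι
      index≢ o refl = o _ refl

    topL-old : ∀ {x} → Old x → topL S′ x ≡ rescale (topL S x)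
    topL-old {inj₁ v} o = refl
    topL-old {inj₂ (j , e)} o = override-old ι P _ e (index≢ o)

    topR-old : ∀ {x} → Old x → topR S′ x ≡ rescale (topR S x)
    topR-old {inj₁ v} o = refl
    topR-old {inj₂ (j , e)} o = override-old ι P _ e (index≢ o)

    botL-old : ∀ {x} → Old x → botL S′ x ≡ rescale (botL S x)
    botL-old {inj₁ v} o = refl
    botL-old {inj₂ (j , e)} o = override-old ι Q _ e (index≢ o)

    botR-old : ∀ {x} → Old x → botR S′ x ≡ rescale (botR S x)
    botR-old {inj₁ v} o = refl
    botR-old {inj₂ (j , e)} o = override-old ι Q _ e (index≢ o)

    leftOf⁺ : ∀ {x y} → Old x → Old y → LeftOf S x y → LeftOf S′ x y
    leftOf⁺ ox oy (h ∧ h′) =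
      subst₂ _<_ (sym (topR-old ox)) (sym (topL-old oy)) (rescale-mono-< h) ∧
      subst₂ _<_ (sym (botR-old ox)) (sym (botL-old oy)) (rescale-mono-< h′)

    leftOf⁻ : ∀ {x y} → Old x → Old y → LeftOf S′ x y → LeftOf S x y
    leftOf⁻ ox oy (h ∧ h′) =
      rescale-cancel-< (subst₂ _<_ (topR-old ox) (topL-old oy) h) ∧
      rescale-cancel-< (subst₂ _<_ (botR-old ox) (botL-old oy) h′)

    -- Top and bottom are optimised separately, so the extremal endpoints may belong to four
    -- different vertices. A vertex to the right of everything before `u` is in particular to the
    -- right of `z₁` and `z₂`, which is what `least` needs.
    bracket : ∀ {H u eL eR z₁ z₂ z₃ z₄} →
      (∀ {x} → present H x → Old x) → Old u →
      Maximal (λ x → present H x × LeftOf S x u) (λ x y → topR S x < topR S y) z₁ →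
      Maximal (λ x → present H x × LeftOf S x u) (λ x y → botR S x < botR S y) z₂ →
      Maximal (λ x → present H x × LeftOf S u x) (λ x y → topL S y < topL S x) z₃ →
      Maximal (λ x → present H x × LeftOf S u x) (λ x y → botL S y < botL S x) z₄ →
      P eL ≡ after (topR S z₁) → Q eL ≡ after (botR S z₂) →
      P eR ≡ before (topL S z₃) → Q eR ≡ before (botL S z₄) →
      Bracket H (LeftOf S′) Old u (inj₂ (ι , eL)) (inj₂ (ι , eR))
    bracket {eL = eL} {eR} old ou ((p₁ , l₁) , m₁) ((p₂ , l₂) , m₂) ((p₃ , l₃) , m₃) ((p₄ , l₄) , m₄)
      P≡ Q≡ P≡′ Q≡′ = record
      { old = old
      ; upper = λ pz z≪u → let l = leftOf⁻ (old pz) ou z≪u in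
          subst₂ _<_ (sym (topR-old (old pz))) (sym top-eL) (rescale<after (≮⇒≥ (m₁ _ (pz , l)))) ∧
          subst₂ _<_ (sym (botR-old (old pz))) (sym bot-eL) (rescale<after (≮⇒≥ (m₂ _ (pz , l))))
      ; least = λ ox h →
          subst₂ _<_ (sym top-eL) (sym (topL-old ox))
            (after<rescale (on-top (leftOf⁻ (old p₁) ox (h _ p₁ (leftOf⁺ (old p₁) ou l₁))))) ∧
          subst₂ _<_ (sym bot-eL) (sym (botL-old ox))
            (after<rescale (on-bot (leftOf⁻ (old p₂) ox (h _ p₂ (leftOf⁺ (old p₂) ou l₂)))))
      ; lower = λ pz u≪z → let l = leftOf⁻ ou (old pz) u≪z in
          subst₂ _<_ (sym top-eR) (sym (topL-old (old pz))) (before<rescale (≮⇒≥ (m₃ _ (pz , l)))) ∧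
          subst₂ _<_ (sym bot-eR) (sym (botL-old (old pz))) (before<rescale (≮⇒≥ (m₄ _ (pz , l))))
      ; greatest = λ ox h →
          subst₂ _<_ (sym (topR-old ox)) (sym top-eR)
            (rescale<before (on-top (leftOf⁻ ox (old p₃) (h _ p₃ (leftOf⁺ ou (old p₃) l₃))))) ∧
          subst₂ _<_ (sym (botR-old ox)) (sym bot-eR)
            (rescale<before (on-bot (leftOf⁻ ox (old p₄) (h _ p₄ (leftOf⁺ ou (old p₄) l₄))))) }
      where
      top-eL = trans (override-new ι P (Layout.top S) eL) P≡
      bot-eL = trans (override-new ι Q (Layout.bot S) eL) Q≡
      top-eR = trans (override-new ι P (Layout.top S) eR) P≡′
      bot-eR = trans (override-new ι Q (Layout.bot S) eR) Q≡′

-- The invariant of the procedure.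

module Procedure {n k : ℕ} (G : SimpleGraph n) (T : TrapRep n) (T-rep : TrapRepresents T G)
  (u : Fin k → Fin n) (u-inj : Injective _≡_ _≡_ u) where

  open Layout

  origin : Vtx n k → Fin n
  origin (inj₁ v) = v
  origin (inj₂ (j , _)) = u j

  Present : ℕ → Vtx n k → Set
  Present i (inj₁ v) = ∀ j → toℕ j < i → u j ≢ v
  Present i (inj₂ (j , _)) = toℕ j < i

  present-dec : ∀ i x → Dec (Present i x)
  present-dec i (inj₁ v) = allF? (λ j → (toℕ j <? i) →-dec ¬? (u j ≟F v))
  present-dec i (inj₂ (j , _)) = toℕ j <? i

  owner : Fin k × Fin 2 → Vtx n k
  owner w = inj₁ (origin (inj₂ w))

  -- This is what keeps arcs under control: a derivative may cross lines that its
  -- owner does not cross, but these belong to vertices that are still unsplit.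
  Guarded : (H : Graph (Vtx n k)) (_≪_ : Vtx n k → Vtx n k → Set) → Fin k × Fin 2 → Set
  Guarded H _≪_ w = inj₂ w ≪ owner w ×
    (∀ x → present H x → x ≪ owner w → x ≢ inj₂ w → Comparable _≪_ x (inj₂ w))

  Sided : Graph (Vtx n k) → Layout k → Fin k × Fin 2 → Set
  Sided H S w = Guarded H (LeftOf T S) w ⊎ Guarded H (flip (LeftOf T S)) w

  DistinctBelow : ℕ → (Fin k × Fin 2 → ℕ) → Set
  DistinctBelow i g = ∀ w w′ → toℕ (proj₁ w) < i → toℕ (proj₁ w′) < i → g w ≡ g w′ → w ≡ w′

  -- `adj-origin` gives irreflexivity at every stage and, at the end, that owners of crossing
  -- derivatives have intersecting trapezoids. Distinctness concerns only the derivatives already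
  -- created, since the others share junk coordinates.
  record Invariant (i : ℕ) (H : Graph (Vtx n k)) (S : Layout k) : Set where
    field
      present⇒    : ∀ x → present H x → Present i x
      present⇐    : ∀ x → Present i x → present H x
      adj-present : ∀ {x y} → adj H x y → present H x × present H y
      adj-origin  : ∀ {x y} → adj H x y → SimpleGraph.Adj G (origin x) (origin y)
      adj⇒        : ∀ {x y} → adj H x y → ¬ Comparable (LeftOf T S) x y
      adj⇐        : ∀ {x y} → present H x → present H y → x ≢ y →
                    ¬ Comparable (LeftOf T S) x y → adj H x y
      sided       : ∀ w → toℕ (proj₁ w) < i → Sided H S w
      top-distinct : DistinctBelow i (top S)
      bot-distinct : DistinctBelow i (bot S)

    model : Model H (LeftOf T S)
    model = record
      { present? = λ x → map′ (present⇐ x) (present⇒ x) (present-dec i x)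
      ; _≪?_ = leftOf? T S ; ≪-trans = leftOf-trans T S ; ≪-irrefl = leftOf-irrefl T S
      ; adj-present = adj-present ; adj-irrefl = SimpleGraph.irrefl G ∘ adj-origin
      ; adj⇒¬≪ = adj⇒ ; ¬≪⇒adj = adj⇐ }

  initial : Layout k
  initial = record { scale = id ; scale-mono = id ; top = λ _ → 0 ; bot = λ _ → 0 }

  initial-invariant : Invariant 0 (H₀ G) initial
  initial-invariant = record
    { present⇒ = λ { (inj₁ v) _ j () ; (inj₂ w) () }
    ; present⇐ = λ { (inj₁ v) _ → _ ; (inj₂ w) () }
    ; adj-present = λ { {inj₁ x} {inj₁ y} _ → _ }
    ; adj-origin = λ { {inj₁ x} {inj₁ y} e → e }
    ; adj⇒ = λ { {inj₁ x} {inj₁ y} e →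
        Equivalence.to (T-rep x y (λ { refl → SimpleGraph.irrefl G e })) e ∘ disjoint }
    ; adj⇐ = λ { {inj₁ x} {inj₁ y} _ _ x≢y h → Equivalence.from (T-rep x y (x≢y ∘ cong inj₁))
        (h ∘ λ { (inj₁ (h , h′)) → inj₁ (h ∧ h′) ; (inj₂ (h , h′)) → inj₂ (h ∧ h′) }) }
    ; sided = λ _ () ; top-distinct = λ _ _ () ; bot-distinct = λ _ _ () }
    where
    disjoint : ∀ {x y} → Comparable (LeftOf T initial) (inj₁ x) (inj₁ y) →
      (b T x < a T y × d T x < c T y) ⊎ (b T y < a T x × d T y < c T x)
    disjoint (inj₁ (h ∧ h′)) = inj₁ (h , h′)
    disjoint (inj₂ (h ∧ h′)) = inj₂ (h , h′)

  -- One splitting step.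

  module Step {i : ℕ} {H : Graph (Vtx n k)} {S : Layout k} (I : Invariant i H S) (i<k : i < k)
    (ch : SplitChoice H (inj₁ (u (fromℕ< i<k)))) where

    open Invariant I
    open SplitChoice ch

    ι : Fin k
    ι = fromℕ< i<k

    U d₁ d₂ : Vtx n k
    U = inj₁ (u ι)
    d₁ = inj₂ (ι , fzero)
    d₂ = inj₂ (ι , fsuc fzero)

    H′ : Graph (Vtx n k)
    H′ = split H U d₁ d₂ ch

    <i⇒≢ι : ∀ {j} → toℕ j < i → j ≢ ι
    <i⇒≢ι j<i refl = <-irrefl (toℕ-fromℕ< i<k) j<i

    <suc⇒ : ∀ {j} → toℕ j < suc i → toℕ j < i ⊎ j ≡ ι
    <suc⇒ j<1+i with m<1+n⇒m<n∨m≡n j<1+i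
    ... | inj₁ j<i = inj₁ j<i
    ... | inj₂ j≡i = inj₂ (toℕ-injective (trans j≡i (sym (toℕ-fromℕ< i<k))))

    ι<suc : toℕ ι < suc i
    ι<suc = subst (_< suc i) (sym (toℕ-fromℕ< i<k)) (n<1+n i)

    U-present : present H U
    U-present = present⇐ U (λ j j<i eq → <i⇒≢ι j<i (u-inj eq))

    d-absent : ∀ e → ¬ present H (inj₂ (ι , e))
    d-absent e pd = <i⇒≢ι (present⇒ _ pd) refl

    present′⇒ : ∀ x → present H′ x → Present (suc i) x
    present′⇒ (inj₁ v) (inj₁ (px , x≢U)) j j<1+i with <suc⇒ j<1+i
    ... | inj₁ j<i = present⇒ _ px j j<i
    ... | inj₂ refl = λ { refl → x≢U refl }
    present′⇒ (inj₁ v) (inj₂ (inj₁ ()))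
    present′⇒ (inj₁ v) (inj₂ (inj₂ ()))
    present′⇒ (inj₂ w) (inj₁ (px , _)) = m≤n⇒m≤1+n (present⇒ _ px)
    present′⇒ (inj₂ w) (inj₂ (inj₁ refl)) = ι<suc
    present′⇒ (inj₂ w) (inj₂ (inj₂ refl)) = ι<suc

    present′⇐ : ∀ x → Present (suc i) x → present H′ x
    present′⇐ (inj₁ v) h = inj₁ (present⇐ _ (λ j j<i → h j (m≤n⇒m≤1+n j<i)) , λ { refl → h ι ι<suc refl })
    present′⇐ (inj₂ (j , e)) h with <suc⇒ h
    ... | inj₁ j<i = inj₁ (present⇐ _ j<i , λ ())
    present′⇐ (inj₂ (j , fzero)) h | inj₂ refl = inj₂ (inj₁ refl)
    present′⇐ (inj₂ (j , fsuc fzero)) h | inj₂ refl = inj₂ (inj₂ refl)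

    kept-or-new : ∀ {x} → present H′ x → present H x ⊎ (x ≡ d₁ ⊎ x ≡ d₂)
    kept-or-new (inj₁ (px , _)) = inj₁ px
    kept-or-new (inj₂ h) = inj₂ h

    nbr-kept : ∀ {r y} → NbrOf H U r y → present H y × y ≢ U
    nbr-kept (uy , _) = proj₂ (adj-present uy) ,
      λ { refl → SimpleGraph.irrefl G (adj-origin uy) }

    adj′-present : ∀ {x y} → adj H′ x y → present H′ x × present H′ y
    adj′-present (inj₁ (x≢U , y≢U , e)) =
      inj₁ (proj₁ (adj-present e) , x≢U) , inj₁ (proj₂ (adj-present e) , y≢U)
    adj′-present (inj₂ (inj₁ (eq , h))) = inj₂ (inj₁ eq) , inj₁ (nbr-kept h)
    adj′-present (inj₂ (inj₂ (inj₁ (eq , h)))) = inj₁ (nbr-kept h) , inj₂ (inj₁ eq)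
    adj′-present (inj₂ (inj₂ (inj₂ (inj₁ (eq , h))))) = inj₂ (inj₂ eq) , inj₁ (nbr-kept h)
    adj′-present (inj₂ (inj₂ (inj₂ (inj₂ (eq , h))))) = inj₁ (nbr-kept h) , inj₂ (inj₂ eq)

    adj′-origin : ∀ {x y} → adj H′ x y → SimpleGraph.Adj G (origin x) (origin y)
    adj′-origin (inj₁ (_ , _ , e)) = adj-origin e
    adj′-origin (inj₂ (inj₁ (refl , e , _))) = adj-origin e
    adj′-origin (inj₂ (inj₂ (inj₁ (refl , e , _)))) = SimpleGraph.sym G (adj-origin e)
    adj′-origin (inj₂ (inj₂ (inj₂ (inj₁ (refl , e , _))))) = adj-origin e
    adj′-origin (inj₂ (inj₂ (inj₂ (inj₂ (refl , e , _))))) = SimpleGraph.sym G (adj-origin e)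

    -- The endpoints stay abstract, so that one argument serves both placements of `d₁` and `d₂`.
    module Lines (P Q : Fin 2 → ℕ) where

      open Extend {n} {k} T S ι P Q public

      _≪_ : Vtx n k → Vtx n k → Set
      _≪_ = LeftOf T S′

      present-old : ∀ {x} → present H x → Old x
      present-old px e refl = d-absent e px

      comparable⁺ : ∀ {x y} → Old x → Old y → Comparable (LeftOf T S) x y → Comparable _≪_ x y
      comparable⁺ ox oy (inj₁ h) = inj₁ (leftOf⁺ ox oy h)
      comparable⁺ ox oy (inj₂ h) = inj₂ (leftOf⁺ oy ox h)

      comparable⁻ : ∀ {x y} → Old x → Old y → Comparable _≪_ x y → Comparable (LeftOf T S) x y
      comparable⁻ ox oy (inj₁ h) = inj₁ (leftOf⁻ ox oy h)
      comparable⁻ ox oy (inj₂ h) = inj₂ (leftOf⁻ oy ox h)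

      model′ : Model H _≪_
      model′ = record
        { present? = Model.present? model
        ; _≪?_ = leftOf? T S′ ; ≪-trans = leftOf-trans T S′ ; ≪-irrefl = leftOf-irrefl T S′
        ; adj-present = adj-present ; adj-irrefl = Model.adj-irrefl model
        ; adj⇒¬≪ = λ e → let px , py = adj-present e in
            adj⇒ e ∘ comparable⁻ (present-old px) (present-old py)
        ; ¬≪⇒adj = λ px py x≢y h →
            adj⇐ px py x≢y (h ∘ comparable⁺ (present-old px) (present-old py)) }

      Realises : Vtx n k → Vtx n k → Set
      Realises d r = ∀ y → (NbrOf H U r y → ¬ Comparable _≪_ d y)
        × (present H y → y ≢ U → ¬ Comparable _≪_ d y → NbrOf H U r y)

      -- The derivatives of one vertex are not adjacent, so their lines must be comparable; this
      -- also separates their endpoints from each other, while freshness separates them from the old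
      -- ones.
      invariant : Realises d₁ r → Realises d₂ s → Comparable _≪_ d₁ d₂ →
        (∀ w → toℕ (proj₁ w) < suc i → Sided H′ S′ w) →
        (∀ e → Fresh (P e)) → (∀ e → Fresh (Q e)) →
        Invariant (suc i) H′ S′
      invariant real₁ real₂ d₁~d₂ sides P-fresh Q-fresh = record
        { present⇒ = present′⇒ ; present⇐ = present′⇐
        ; adj-present = adj′-present ; adj-origin = adj′-origin
        ; adj⇒ = adj′⇒ ; adj⇐ = adj′⇐ ; sided = sides
        ; top-distinct = distinct P-fresh (P≢ d₁~d₂) top-distinct
        ; bot-distinct = distinct Q-fresh (Q≢ d₁~d₂) bot-distinct }
        where
        P≢ : Comparable _≪_ d₁ d₂ → P fzero ≢ P (fsuc fzero)
        P≢ (inj₁ (h ∧ _)) = <⇒≢ (subst₂ _<_ (override-new ι P _ _) (override-new ι P _ _) h)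
        P≢ (inj₂ (h ∧ _)) = <⇒≢ (subst₂ _<_ (override-new ι P _ _) (override-new ι P _ _) h) ∘ sym

        Q≢ : Comparable _≪_ d₁ d₂ → Q fzero ≢ Q (fsuc fzero)
        Q≢ (inj₁ (_ ∧ h)) = <⇒≢ (subst₂ _<_ (override-new ι Q _ _) (override-new ι Q _ _) h)
        Q≢ (inj₂ (_ ∧ h)) = <⇒≢ (subst₂ _<_ (override-new ι Q _ _) (override-new ι Q _ _) h) ∘ sym

        adj′⇒ : ∀ {x y} → adj H′ x y → ¬ Comparable _≪_ x y
        adj′⇒ (inj₁ (_ , _ , e)) = Model.adj⇒¬≪ model′ e
        adj′⇒ (inj₂ (inj₁ (refl , h))) = proj₁ (real₁ _) h
        adj′⇒ (inj₂ (inj₂ (inj₁ (refl , h)))) = proj₁ (real₁ _) h ∘ ⊎-swap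
        adj′⇒ (inj₂ (inj₂ (inj₂ (inj₁ (refl , h))))) = proj₁ (real₂ _) h
        adj′⇒ (inj₂ (inj₂ (inj₂ (inj₂ (refl , h))))) = proj₁ (real₂ _) h ∘ ⊎-swap

        adj′⇐ : ∀ {x y} → present H′ x → present H′ y → x ≢ y →
                ¬ Comparable _≪_ x y → adj H′ x y
        adj′⇐ (inj₁ (px , x≢U)) (inj₁ (py , y≢U)) x≢y h =
          inj₁ (x≢U , y≢U , Model.¬≪⇒adj model′ px py x≢y h)
        adj′⇐ (inj₁ (px , x≢U)) (inj₂ (inj₁ refl)) _ h =
          inj₂ (inj₂ (inj₁ (refl , proj₂ (real₁ _) px x≢U (h ∘ ⊎-swap))))
        adj′⇐ (inj₁ (px , x≢U)) (inj₂ (inj₂ refl)) _ h =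
          inj₂ (inj₂ (inj₂ (inj₂ (refl , proj₂ (real₂ _) px x≢U (h ∘ ⊎-swap)))))
        adj′⇐ (inj₂ (inj₁ refl)) (inj₁ (py , y≢U)) _ h =
          inj₂ (inj₁ (refl , proj₂ (real₁ _) py y≢U h))
        adj′⇐ (inj₂ (inj₂ refl)) (inj₁ (py , y≢U)) _ h =
          inj₂ (inj₂ (inj₂ (inj₁ (refl , proj₂ (real₂ _) py y≢U h))))
        adj′⇐ (inj₂ (inj₁ refl)) (inj₂ (inj₁ refl)) x≢y _ = contradiction refl x≢y
        adj′⇐ (inj₂ (inj₁ refl)) (inj₂ (inj₂ refl)) _ h = contradiction d₁~d₂ h
        adj′⇐ (inj₂ (inj₂ refl)) (inj₂ (inj₁ refl)) _ h = contradiction (⊎-swap d₁~d₂) h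
        adj′⇐ (inj₂ (inj₂ refl)) (inj₂ (inj₂ refl)) x≢y _ = contradiction refl x≢y

        distinct : ∀ {N g} → (∀ e → Fresh (N e)) → N fzero ≢ N (fsuc fzero) →
          DistinctBelow i g → DistinctBelow (suc i) (override ι N g)
        distinct {N} {g} fresh N≢ dist (j , e) (j′ , e′) h h′ eq with <suc⇒ h | <suc⇒ h′
        ... | inj₁ j<i | inj₁ j′<i = dist _ _ j<i j′<i (rescale-injective {g (j , e)}
          (trans (sym (override-old ι N g e (<i⇒≢ι j<i)))
            (trans eq (override-old ι N g e′ (<i⇒≢ι j′<i)))))
        ... | inj₁ j<i | inj₂ refl = contradiction
          (trans (sym (override-new ι N g e′)) (trans (sym eq) (override-old ι N g e (<i⇒≢ι j<i))))
          (fresh e′ (g (j , e)))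
        ... | inj₂ refl | inj₁ j′<i = contradiction
          (trans (sym (override-new ι N g e)) (trans eq (override-old ι N g e′ (<i⇒≢ι j′<i))))
          (fresh e (g (j′ , e′)))
        ... | inj₂ refl | inj₂ refl = cong (ι ,_) (same e e′
          (trans (sym (override-new ι N g e)) (trans eq (override-new ι N g e′))))
          where
          same : ∀ e e′ → N e ≡ N e′ → e ≡ e′
          same fzero fzero _ = refl
          same fzero (fsuc fzero) eq = contradiction eq N≢
          same (fsuc fzero) fzero eq = contradiction (sym eq) N≢
          same (fsuc fzero) (fsuc fzero) _ = refl

      sided-old : ∀ {dL dR} → Bracket H _≪_ Old U dL dR →
        (∀ {x} → present H′ x → present H x ⊎ (x ≡ dL ⊎ x ≡ dR)) →
        ∀ w → toℕ (proj₁ w) < i → Sided H′ S′ w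
      sided-old B kept w w<i with sided w w<i
      ... | inj₁ (w≪t , guard) = inj₁ (leftOf⁺ (present-old pw) (λ _ ()) w≪t , λ x px →
            Splitting.guard-old (vertices n k) model′ U-present B pw (λ ())
              (λ x px x≪t x≢w → comparable⁺ (present-old px) (present-old pw)
                (guard x px (leftOf⁻ (present-old px) (λ _ ()) x≪t) x≢w))
              (kept px))
        where pw = present⇐ (inj₂ w) w<i
      ... | inj₂ (w≪t , guard) = inj₂ (leftOf⁺ (λ _ ()) (present-old pw) w≪t , λ x px →
            Splitting.guard-old (vertices n k) (reflect model′) U-present (reflect-bracket B) pw (λ ())
              (λ x px x≪t x≢w → ⊎-swap (comparable⁺ (present-old px) (present-old pw)
                (⊎-swap (guard x px (leftOf⁻ (λ _ ()) (present-old px) x≪t) x≢w))))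
              (map₂ ⊎-swap (kept px)))
        where pw = present⇐ (inj₂ w) w<i

      module Sides {dL dR} (B : Bracket H _≪_ Old U dL dR)
        (kept : ∀ {x} → present H′ x → present H x ⊎ (x ≡ dL ⊎ x ≡ dR)) where

        private
          module L = Splitting (vertices n k) model′ U-present B
          module R = Splitting (vertices n k) (reflect model′) U-present (reflect-bracket B)
        open L public using (dL≪u; u≪dR)

        guard-L : ∀ x → present H′ x → x ≪ U → x ≢ dL → Comparable _≪_ x dL
        guard-L x px = L.guard-new (kept px)

        guard-R : ∀ x → present H′ x → U ≪ x → x ≢ dR → Comparable (flip _≪_) x dR
        guard-R x px = R.guard-new (map₂ ⊎-swap (kept px))

        dL≪dR : dL ≪ dR
        dL≪dR = leftOf-trans T S′ dL≪u u≪dR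

        realises-L : ∀ {r} → present H r × r ≪ U → OneSide.Dominates (vertices n k) model′ U-present r →
          Realises dL r
        realises-L left-r dom y = L.nbr⇒crosses left-r , L.crosses⇒nbr dom

        realises-R : ∀ {r} → present H r × U ≪ r →
          OneSide.Dominates (vertices n k) (reflect model′) U-present r → Realises dR r
        realises-R right-r dom y = (λ h → R.nbr⇒crosses right-r h ∘ ⊎-swap) ,
          λ py y≢U h → R.crosses⇒nbr dom py y≢U (h ∘ ⊎-swap)

    pair : ℕ → ℕ → Fin 2 → ℕ
    pair x y fzero = x
    pair x y (fsuc fzero) = y

    pair-fresh : ∀ {x y} → Fresh x → Fresh y → ∀ e → Fresh (pair x y e)
    pair-fresh fx fy fzero = fx
    pair-fresh fx fy (fsuc fzero) = fy

    present-r : present H r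
    present-r = proj₁ (proj₁ r-master)

    present-s : present H s
    present-s = proj₁ (proj₁ (proj₁ s-maximal))

    -- On the side of `r`, the neighbourhood of the component of `s` would be contained in that of
    -- the master component, against membership in `D*`.
    opposite : ∀ {_≪_} (M : Model H _≪_) → r ≪ U → U ≪ s
    opposite M r≪U with OneSide.inW-side (vertices n k) M U-present (proj₁ (proj₁ s-maximal))
    ... | inj₂ U≪s = U≪s
    ... | inj₁ s≪U = contradiction
      (OneSide.master-dominates (vertices n k) M U-present (present-r , r≪U) r-master s (present-s , s≪U))
      (proj₂ (proj₁ s-maximal))

    -- `l` and `ρ` are `r` and `s` in the order in which they surround `U`; they make both sides
    -- nonempty, so extremal endpoints exist.
    module Extremes {l ρ} (left-l : present H l × LeftOf T S l U)
      (right-ρ : present H ρ × LeftOf T S U ρ) where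

      open Finite (vertices n k) using (maximal)

      private
        left? : ∀ x → Dec (present H x × LeftOf T S x U)
        left? x = Model.present? model x ×-dec leftOf? T S x U
        right? : ∀ x → Dec (present H x × LeftOf T S U x)
        right? x = Model.present? model x ×-dec leftOf? T S U x

      z₁ = maximal left? (λ x y → topR T S x <? topR T S y) <-trans (<-irrefl refl) (l , left-l)
      z₂ = maximal left? (λ x y → botR T S x <? botR T S y) <-trans (<-irrefl refl) (l , left-l)
      z₃ = maximal right? (λ x y → topL T S y <? topL T S x) (flip <-trans) (<-irrefl refl) (ρ , right-ρ)
      z₄ = maximal right? (λ x y → botL T S y <? botL T S x) (flip <-trans) (<-irrefl refl) (ρ , right-ρ)

      topᴸ = after (topR T S (proj₁ z₁))
      botᴸ = after (botR T S (proj₁ z₂))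
      topᴿ = before (topL T S (proj₁ z₃))
      botᴿ = before (botL T S (proj₁ z₄))

    next : ∃ (Invariant (suc i) H′)
    next with OneSide.inW-side (vertices n k) model U-present (proj₁ r-master)
    ... | inj₁ r≪U = _ , invariant (realises-L left-r (OneSide.master-dominates (vertices n k) model′ U-present left-r r-master))
        (realises-R right-s (OneSide.maximal-dominates (vertices n k) (reflect model′) U-present right-s s-maximal))
        (inj₁ dL≪dR) sides
        (pair-fresh (after-fresh (topR T S (proj₁ z₁))) (before-fresh (topL T S (proj₁ z₃))))
        (pair-fresh (after-fresh (botR T S (proj₁ z₂))) (before-fresh (botL T S (proj₁ z₄))))
      where
      U≪s = opposite model r≪U
      open Extremes (present-r , r≪U) (present-s , U≪s)
      open Lines (pair topᴸ topᴿ) (pair botᴸ botᴿ)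
      B : Bracket H _≪_ Old U d₁ d₂
      B = bracket present-old (λ _ ()) (proj₂ z₁) (proj₂ z₂) (proj₂ z₃) (proj₂ z₄) refl refl refl refl
      open Sides B kept-or-new
      left-r : present H r × r ≪ U
      left-r = present-r , leftOf⁺ (present-old present-r) (λ _ ()) r≪U
      right-s : present H s × U ≪ s
      right-s = present-s , leftOf⁺ (λ _ ()) (present-old present-s) U≪s
      sides : ∀ w → toℕ (proj₁ w) < suc i → Sided H′ S′ w
      sides (j , e) h with <suc⇒ h
      ... | inj₁ j<i = sided-old B kept-or-new (j , e) j<i
      sides (j , fzero) h | inj₂ refl = inj₁ (dL≪u , guard-L)
      sides (j , fsuc fzero) h | inj₂ refl = inj₂ (u≪dR , guard-R)
    ... | inj₂ U≪r = _ , invariant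
        (realises-R right-r (OneSide.master-dominates (vertices n k) (reflect model′) U-present right-r r-master))
        (realises-L left-s (OneSide.maximal-dominates (vertices n k) model′ U-present left-s s-maximal))
        (inj₂ dL≪dR) sides
        (pair-fresh (before-fresh (topL T S (proj₁ z₃))) (after-fresh (topR T S (proj₁ z₁))))
        (pair-fresh (before-fresh (botL T S (proj₁ z₄))) (after-fresh (botR T S (proj₁ z₂))))
      where
      s≪U = opposite (reflect model) U≪r
      open Extremes (present-s , s≪U) (present-r , U≪r)
      -- The derivative `d₁` always belongs to the master component, which now lies to the right of
      -- `U`; hence the swapped pairs.
      open Lines (pair topᴿ topᴸ) (pair botᴿ botᴸ)
      B : Bracket H _≪_ Old U d₂ d₁
      B = bracket present-old (λ _ ()) (proj₂ z₁) (proj₂ z₂) (proj₂ z₃) (proj₂ z₄) refl refl refl refl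
      open Sides B (map₂ ⊎-swap ∘ kept-or-new)
      right-r : present H r × U ≪ r
      right-r = present-r , leftOf⁺ (λ _ ()) (present-old present-r) U≪r
      left-s : present H s × s ≪ U
      left-s = present-s , leftOf⁺ (present-old present-s) (λ _ ()) s≪U
      sides : ∀ w → toℕ (proj₁ w) < suc i → Sided H′ S′ w
      sides (j , e) h with <suc⇒ h
      ... | inj₁ j<i = sided-old B (map₂ ⊎-swap ∘ kept-or-new) (j , e) j<i
      sides (j , fzero) h | inj₂ refl = inj₂ (u≪dR , guard-R)
      sides (j , fsuc fzero) h | inj₂ refl = inj₁ (dL≪u , guard-L)

  run-invariant : ∀ {i H} → Run G u i H → ∃ (Invariant i H)
  run-invariant start = initial , initial-invariant
  run-invariant (step i<k run ch) = Step.next (proj₂ (run-invariant run)) i<k ch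

  -- The permutation representation of the derivatives and its acyclicity.

  module Result {H : Graph (Vtx n k)} {S : Layout k} (I : Invariant k H S) where

    open Invariant I

    R : PermRep (Fin k × Fin 2)
    R = record { p = top S ; q = bot S
               ; p-inj = λ {w} {w′} → top-distinct w w′ (toℕ<n _) (toℕ<n _)
               ; q-inj = λ {w} {w′} → bot-distinct w w′ (toℕ<n _) (toℕ<n _) }

    derivative-present : ∀ w → present H (inj₂ w)
    derivative-present w = present⇐ _ (toℕ<n _)

    cross⇒incomparable : ∀ {w w′} → Cross R w w′ → ¬ Comparable (LeftOf T S) (inj₂ w) (inj₂ w′)
    cross⇒incomparable (inj₁ (_ , h)) (inj₁ (_ ∧ h′)) = <-asym h h′
    cross⇒incomparable (inj₁ (h , _)) (inj₂ (h′ ∧ _)) = <-asym h h′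
    cross⇒incomparable (inj₂ (h , _)) (inj₁ (h′ ∧ _)) = <-asym h h′
    cross⇒incomparable (inj₂ (_ , h)) (inj₂ (_ ∧ h′)) = <-asym h h′

    incomparable⇒cross : ∀ {w w′} → w ≢ w′ → ¬ Comparable (LeftOf T S) (inj₂ w) (inj₂ w′) → Cross R w w′
    incomparable⇒cross {w} {w′} w≢w′ h with <-cmp (top S w) (top S w′) | <-cmp (bot S w) (bot S w′)
    ... | tri≈ _ eq _ | _ = contradiction (p-inj R eq) w≢w′
    ... | _ | tri≈ _ eq _ = contradiction (q-inj R eq) w≢w′
    ... | tri< t _ _ | tri< b _ _ = contradiction (inj₁ (t ∧ b)) h
    ... | tri< t _ _ | tri> _ _ b = inj₁ (t , b)
    ... | tri> _ _ t | tri< b _ _ = inj₂ (t , b)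
    ... | tri> _ _ t | tri> _ _ b = contradiction (inj₂ (t ∧ b)) h

    cross⇒adj : ∀ {w w′} → Cross R w w′ → adj H (inj₂ w) (inj₂ w′)
    cross⇒adj {w} {w′} x = adj⇐ (derivative-present w) (derivative-present w′)
      (λ { refl → [ <-irrefl refl ∘ proj₁ , <-irrefl refl ∘ proj₁ ]′ x }) (cross⇒incomparable x)

    represents : Represents R (λ w w′ → adj H (inj₂ w) (inj₂ w′))
    represents w w′ = mk⇔
      (λ e → incomparable⇒cross (λ { refl → SimpleGraph.irrefl G (adj-origin e) }) (adj⇒ e)) cross⇒adj

    derivatives-only : ∀ x → InGsharp u H x ⇔ Σ (Fin k × Fin 2) (λ w → x ≡ inj₂ w)
    derivatives-only x = mk⇔ (to x) λ { (w , refl) → derivative-present w , λ () }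
      where
      to : ∀ x → InGsharp u H x → Σ (Fin k × Fin 2) (λ w → x ≡ inj₂ w)
      to (inj₁ v) (px , h) = ⊥-elim (h (v , refl , λ j → present⇒ _ px j (toℕ<n j)))
      to (inj₂ w) _ = w , refl

    scale-cancel : ∀ {x y} → scale S x < scale S y → x < y
    scale-cancel {x} {y} h with <-cmp x y
    ... | tri< x<y _ _ = x<y
    ... | tri≈ _ refl _ = contradiction h (<-irrefl refl)
    ... | tri> _ _ y<x = contradiction h (<-asym (scale-mono S y<x))

    module _ {W : Set} (R : PermRep W) where

      -- For crossing lines the angle is decided by the order of the endpoints: the line further
      -- right on top and further left at the bottom has the smaller angle.
      arc⇒ : ∀ {x y} → PhiArc R x y → p R y < p R x × q R x < q R y
      arc⇒ (inj₁ (h , h′) , θ) = contradiction (+-mono-< h h′) (<-asym θ)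
      arc⇒ (inj₂ c , _) = c

      ⇒arc : ∀ {x y} → p R y < p R x → q R x < q R y → PhiArc R x y
      ⇒arc h h′ = inj₂ (h , h′) , +-mono-< h h′

    arc-of : ∀ {v v′} {e e′ : Fin 2} → p (lines T) (v′ , e′) < p (lines T) (v , e) →
      q (lines T) (v , e) < q (lines T) (v′ , e′) →
      Σ (Fin n × Fin 2) λ x → Σ (Fin n × Fin 2) λ y → proj₁ x ≡ v × proj₁ y ≡ v′ × PhiArc (lines T) x y
    arc-of h h′ = _ , _ , refl , refl , ⇒arc (lines T) h h′

    -- The lines of T that cross are those on the same sides as the derivatives.
    arc-origin : ∀ {w w′} → proj₁ w ≢ proj₁ w′ → PhiArc R w w′ →
      FArc (lines T) proj₁ (u (proj₁ w)) (u (proj₁ w′))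
    arc-origin {w@(i , _)} {w′@(j , _)} i≢j arc = i≢j ∘ u-inj , found (sided w (toℕ<n i)) (sided w′ (toℕ<n j))
      where
      top> : top S w′ < top S w
      top> = proj₁ (arc⇒ R arc)
      bot< : bot S w < bot S w′
      bot< = proj₂ (arc⇒ R arc)
      apart : ¬ Comparable (LeftOf T S) (inj₂ w) (inj₂ w′)
      apart = cross⇒incomparable (proj₁ arc)
      w≢w′ : inj₂ {A = Fin n} w ≢ inj₂ w′
      w≢w′ refl = i≢j refl
      meet : TrapIntersect T (u i) (u j)
      meet = Equivalence.to (T-rep _ _ (i≢j ∘ u-inj)) (adj-origin (cross⇒adj (proj₁ arc)))
      c≢d : ∀ {v v′} → v ≢ v′ → c T v ≢ d T v′
      c≢d v≢v′ eq = v≢v′ (cong proj₁ (q-inj (lines T)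
        (trans (lines-q0 T _) (trans eq (sym (lines-q1 T _))))))
      a≢b : ∀ {v v′} → v ≢ v′ → a T v ≢ b T v′
      a≢b v≢v′ eq = v≢v′ (cong proj₁ (p-inj (lines T)
        (trans (lines-p0 T _) (trans eq (sym (lines-p1 T _))))))

      found : Sided H S w → Sided H S w′ →
        Σ (Fin n × Fin 2) λ x → Σ (Fin n × Fin 2) λ y → proj₁ x ≡ u i × proj₁ y ≡ u j × PhiArc (lines T) x y
      found (inj₁ ((wt ∧ wb) , gw)) (inj₁ ((wt′ ∧ wb′) , gw′)) = arc-of {e = fzero} {fzero}
        (subst₂ _<_ (sym (lines-p0 T _)) (sym (lines-p0 T _)) (scale-cancel (≤-<-trans
          -- Otherwise `w` would lie entirely to the left of the owner of `w′`, and the guard of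
          -- `w′` would make the two crossing derivatives comparable. The other inequality uses the
          -- guard of `w` in the same way.
          (≮⇒≥ λ h → apart (gw′ _ (derivative-present w) (h ∧ <-trans bot< wb′) w≢w′)) wt)))
        (subst₂ _<_ (sym (lines-q0 T _)) (sym (lines-q0 T _)) (scale-cancel (≤-<-trans
          (≮⇒≥ λ h → apart (⊎-swap (gw _ (derivative-present w′) (<-trans top> wt ∧ h) (w≢w′ ∘ sym)))) wb′)))
      found (inj₁ ((wt ∧ wb) , gw)) (inj₂ ((wt′ ∧ wb′) , gw′)) = arc-of {e = fzero} {fsuc fzero}
        (subst₂ _<_ (sym (lines-p1 T _)) (sym (lines-p0 T _)) b<a)
        (subst₂ _<_ (sym (lines-q0 T _)) (sym (lines-q1 T _))
          -- For derivatives on different sides no guard is used: the owners are already separated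
          -- on top, and as their trapezoids intersect they cannot be separated in the same order at
          -- the bottom.
          (≤∧≢⇒< (≮⇒≥ λ h → meet (inj₂ (b<a , h))) (c≢d (i≢j ∘ u-inj))))
        where b<a = scale-cancel (<-trans wt′ (<-trans top> wt))
      found (inj₂ ((wt ∧ wb) , gw)) (inj₁ ((wt′ ∧ wb′) , gw′)) = arc-of {e = fsuc fzero} {fzero}
        (subst₂ _<_ (sym (lines-p0 T _)) (sym (lines-p1 T _))
          (≤∧≢⇒< (≮⇒≥ λ h → meet (inj₁ (h , d<c))) (a≢b (i≢j ∘ u-inj ∘ sym))))
        (subst₂ _<_ (sym (lines-q1 T _)) (sym (lines-q0 T _)) d<c)
        where d<c = scale-cancel (<-trans wb (<-trans bot< wb′))
      found (inj₂ ((wt ∧ wb) , gw)) (inj₂ ((wt′ ∧ wb′) , gw′)) = arc-of {e = fsuc fzero} {fsuc fzero}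
        (subst₂ _<_ (sym (lines-p1 T _)) (sym (lines-p1 T _)) (scale-cancel (<-≤-trans wt′
          (≮⇒≥ λ h → apart (gw _ (derivative-present w′) (h ∧ <-trans wb bot<) (w≢w′ ∘ sym))))))
        (subst₂ _<_ (sym (lines-q1 T _)) (sym (lines-q1 T _)) (scale-cancel (<-≤-trans wb
          (≮⇒≥ λ h → apart (⊎-swap (gw′ _ (derivative-present w) (<-trans wt′ top> ∧ h) w≢w′))))))

    farc-origin : ∀ {i j} → FArc R proj₁ i j → FArc (lines T) proj₁ (u i) (u j)
    farc-origin (i≢j , _ , _ , refl , refl , arc) = arc-origin i≢j arc

    path-origin : ∀ {i j} → TransClosure (FArc R proj₁) i j →
      TransClosure (FArc (lines T) proj₁) (u i) (u j)
    path-origin [ e ] = [ farc-origin e ]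
    path-origin (e ∷ es) = farc-origin e ∷ path-origin es

    acyclic : AcyclicWrt (lines T) proj₁ → AcyclicWrt R proj₁
    acyclic T-acyclic i cycle = T-acyclic (u i) (path-origin cycle)

theorem2p14 : ∀ {n k : ℕ} (G : SimpleGraph n) → IsTrapezoidGraph G →
    (u : Fin k → Fin n) → Injective _≡_ _≡_ u →
    (∀ i → DeltaStarNonempty (H₀ {n} {k} G) (inj₁ (u i))) →
    ∀ (H : Graph (Vtx n k)) → Run G u k H →
    (∀ x → InGsharp u H x ⇔ Σ (Fin k × Fin 2) (λ w → x ≡ inj₂ w))
    × IsPermutationGraph (Fin k × Fin 2) (λ w w′ → adj H (inj₂ w) (inj₂ w′))
    × (IsAcyclicTrapezoidGraph G →
    IsAcyclicPermutationGraphPairs k (λ w w′ → adj H (inj₂ w) (inj₂ w′)))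
theorem2p14 G (T , T-rep) u u-inj _ H run =
  derivatives-only , (R , represents) , λ (T′ , T′-rep , T′-acyclic) →
    -- A run depends only on `G`, so the same run is analysed again with the acyclic representation,
    -- which may differ from `T`.
    let module P = Procedure G T′ T′-rep u u-inj
        module Q = P.Result (proj₂ (P.run-invariant run))
    in Q.R , Q.represents , Q.acyclic T′-acyclic
  where
  open Procedure G T T-rep u u-inj
  open Result (proj₂ (run-invariant run))
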